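{- Given a budget $B\in\mathbb{R}_{++}^m$, uncertainty window $[\tau_1,\tau_2]$, prediction $T_P\in[\tau_1,\tau_2]$, required level of consistency $\beta\in[0,1]$ and required level of competitiveness $\gamma\in[0,\beta]$ as input, let $\vec\lambda^*$ be the sequence computed by the Optimal Target Consumption Sequence algorithm (described in the context). Then: 1. $c(\vec\lambda^*,T_P)\ge\beta$ and $\min_{T\in[\tau_1,\tau_2]}c(\vec\lambda^*,T)\ge\gamma$. 2. $\sum_{t=1}^{\tau_2}\lambda_t^*\le B$ if and only if there exists a target consumption sequence $\vec\lambda'$ (with $\sum_{t=1}^{\tau_2}\lambda_t'\le B$) which satisfies $c(\vec\lambda',T_P)\ge\beta$ and $\min_{T\in[\tau_1,\tau_2]}c(\vec\lambda',T)\ge\gamma$.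
   Context: $m\ge1$ is the number of resources; $1\le\tau_1\le\tau_2$ are integers; $T$ and $T_P$ range over integers in $[\tau_1,\tau_2]$; $\rho_T=B/T\in\mathbb{R}_{++}^m$; vector inequalities are componentwise; $a^+=\max\{a,0\}$. A target consumption sequence is a sequence $\vec\lambda=(\lambda_1,\dots,\lambda_{\tau_2})$ with $\lambda_t\in\mathbb{R}_+^m$ for all $t$, $\lambda_1>0$, and $\sum_{t=1}^{\tau_2}\lambda_t\le B$. For any sequence $\vec\lambda$ of vectors in $\mathbb{R}_+^m$, $$c(\vec\lambda,T)=\frac1T\sum_{t=1}^T\min\Big\{\min_{1\le j\le m}\frac{\lambda_{t,j}}{\rho_{T,j}},1\Big\}.$$ Optimal Target Consumption Sequence algorithm. Initialize $\lambda_{t,j}\leftarrow0$ for all $t\in\{1,\dots,\tau_2\}$, $j\in\{1,\dots,m\}$. For $T=\tau_2$ down to $\tau_1$ (outer loop), and for $t=1$ to $T$ (inner loop), update, for every $j\in\{1,\dots,m\}$, $$\lambda_{t,j}\leftarrow\lambda_{t,j}+\Big(\min\Big\{\rho_{T,j}-\lambda_{t,j},\ a_T\cdot B_j-\sum_{s=1}^T\lambda_{s,j}\Big\}\Big)^+,$$ where $a_T=\beta$ if $T=T_P$ and $a_T=\gamma$ if $T\ne T_P$. The sequence $\vec\lambda^*$ is the final value of $\vec\lambda$. The algorithm returns TRUE if $\sum_{t=1}^{\tau_2}\lambda_t^*\le B$ and FALSE otherwise. -}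

module Defs where

open import Algebra.Bundles using (CommutativeRing)
open import Algebra.Core using (Op₁; Op₂)
open import Algebra.Structures using (IsCommutativeRing)
import Algebra.Construct.NaturalChoice.Max
import Algebra.Construct.NaturalChoice.Min
import Algebra.Properties.CommutativeMonoid.Sum
import Algebra.Properties.Monoid.Mult
open import Data.Bool.Base using (if_then_else_)
open import Data.Fin.Base using (toℕ)
open import Data.Nat.Base as ℕ using (ℕ; zero; suc; NonZero)
open import Data.Nat.Properties using (_≟_)
open import Data.Product.Base using (_×_)
open import Data.Vec.Functional using (Vector; head; tail)
open import Level using (Level; _⊔_)
open import Relation.Binary.Bundles using (TotalOrder)
open import Relation.Binary.Core using (Rel)
open import Relation.Binary.Structures using (IsDecTotalOrder)
import Relation.Binary.Construct.NonStrictToStrict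
open import Relation.Nullary.Decidable.Core using (does)
open import Relation.Nullary.Negation.Core using (¬_)

-- The reals enter only through the axioms of a linearly ordered field.
-- The inverse is total, with an unspecified value at 0#; below it is applied
-- only to positive elements.
record OrderedField (a ℓ₁ ℓ₂ : Level) : Set (Level.suc (a ⊔ ℓ₁ ⊔ ℓ₂)) where
  infix  8 -_
  infix  9 _⁻¹
  infixl 7 _*_
  infixl 6 _+_
  infix  4 _≈_ _≤_
  field
    Carrier           : Set a
    _≈_               : Rel Carrier ℓ₁
    _≤_               : Rel Carrier ℓ₂
    _+_               : Op₂ Carrier
    _*_               : Op₂ Carrier
    -_                : Op₁ Carrier
    _⁻¹               : Op₁ Carrier
    0#                : Carrier
    1#                : Carrier
    isCommutativeRing : IsCommutativeRing _≈_ _+_ _*_ -_ 0# 1#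
    isDecTotalOrder   : IsDecTotalOrder _≈_ _≤_
    0≉1               : ¬ (0# ≈ 1#)
    *-inverseʳ        : ∀ x → ¬ (x ≈ 0#) → x * x ⁻¹ ≈ 1#
    +-monoʳ-≤         : ∀ x {y z} → y ≤ z → x + y ≤ x + z
    *-nonNegative     : ∀ {x y} → 0# ≤ x → 0# ≤ y → 0# ≤ x * y

  commutativeRing : CommutativeRing a ℓ₁
  commutativeRing = record { isCommutativeRing = isCommutativeRing }

  totalOrder : TotalOrder a ℓ₁ ℓ₂
  totalOrder = record { isTotalOrder = IsDecTotalOrder.isTotalOrder isDecTotalOrder }

  open CommutativeRing commutativeRing public
    using (_-_; +-monoid; +-commutativeMonoid)
  open Relation.Binary.Construct.NonStrictToStrict _≈_ _≤_ public using (_<_)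
  open Algebra.Construct.NaturalChoice.Min totalOrder public using (_⊓_)
  open Algebra.Construct.NaturalChoice.Max totalOrder public
    using () renaming (_⊔_ to _⊔′_)
  open Algebra.Properties.CommutativeMonoid.Sum +-commutativeMonoid public
    using (sum)

  infixl 7 _÷_
  _÷_ : Op₂ Carrier
  x ÷ y = x * y ⁻¹

  _⁺ : Op₁ Carrier
  x ⁺ = x ⊔′ 0#

  fromℕ : ℕ → Carrier
  fromℕ n = n Mult.× 1#
    where module Mult = Algebra.Properties.Monoid.Mult +-monoid

  -- f 1 + … + f n
  Σ₁ : ℕ → (ℕ → Carrier) → Carrier
  Σ₁ n f = sum {n} (λ i → f (suc (toℕ i)))

  minimum : ∀ {n} → .{{NonZero n}} → Vector Carrier n → Carrier
  minimum {suc zero}    v = head v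
  minimum {suc (suc n)} v = head v ⊓ minimum (tail v)

  -- Minimum of f k, f (k + 1), …, f l; meaningful when k ≤ l.
  minRange : ℕ → ℕ → (ℕ → Carrier) → Carrier
  minRange k l f = minimum {suc (l ℕ.∸ k)} (λ i → f (k ℕ.+ toℕ i))

module Consumption {a ℓ₁ ℓ₂ : Level} (K : OrderedField a ℓ₁ ℓ₂)
                   {m : ℕ} .{{m≢0 : NonZero m}}
                   (B : Vector (OrderedField.Carrier K) m) where
  open OrderedField K

  -- Time is 1-based: of a sequence on {1, …, τ₂} only the entries at these
  -- times are ever constrained or read.
  Sequence : Set a
  Sequence = ℕ → Vector Carrier m

  ρ : ℕ → Vector Carrier m
  ρ T j = B j ÷ fromℕ T

  c : Sequence → ℕ → Carrier
  c lam T = fromℕ T ⁻¹ * Σ₁ T (λ t → minimum (λ j → lam t j ÷ ρ T j) ⊓ 1#)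

  WithinBudget : ℕ → Sequence → Set ℓ₂
  WithinBudget τ₂ lam = ∀ j → Σ₁ τ₂ (λ t → lam t j) ≤ B j

  IsTargetConsumption : ℕ → Sequence → Set (ℓ₁ ⊔ ℓ₂)
  IsTargetConsumption τ₂ lam =
      (∀ t → 1 ℕ.≤ t → t ℕ.≤ τ₂ → ∀ j → 0# ≤ lam t j)
    × (∀ j → 0# < lam 1 j)
    × WithinBudget τ₂ lam

  -- The body of the inner loop, where α stands for a_T.
  update : Carrier → ℕ → ℕ → Sequence → Sequence
  update α T t lam s j =
    if does (s ≟ t)
    then lam t j + ((ρ T j - lam t j) ⊓ (α * B j - Σ₁ T (λ r → lam r j))) ⁺
    else lam s j

  -- Runs the body for t = 1, …, n in this order.
  innerLoop : Carrier → ℕ → ℕ → Sequence → Sequence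
  innerLoop α T zero    lam = lam
  innerLoop α T (suc n) lam = update α T (suc n) (innerLoop α T n lam)

  level : (T_P : ℕ) (β γ : Carrier) → ℕ → Carrier
  level T_P β γ T = if does (T ≟ T_P) then β else γ

  -- Runs the inner loop for T = τ₁ + n - 1, …, τ₁ in this order.
  outerLoop : (τ₁ T_P : ℕ) (β γ : Carrier) → ℕ → Sequence → Sequence
  outerLoop τ₁ T_P β γ zero    lam = lam
  outerLoop τ₁ T_P β γ (suc n) lam =
    outerLoop τ₁ T_P β γ n (innerLoop (level T_P β γ T) T T lam)
    where T = τ₁ ℕ.+ n

  optimalSequence : (τ₁ τ₂ T_P : ℕ) (β γ : Carrier) → Sequence
  optimalSequence τ₁ τ₂ T_P β γ =
    outerLoop τ₁ T_P β γ (suc τ₂ ℕ.∸ τ₁) (λ _ _ → 0#)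

{-# OPTIONS --safe #-}
module Submission where

-- Resources do not interact, and the computed sequence stays proportional to B,
-- so consistency and competitiveness can be read off a single resource: after
-- the pass for T no entry exceeds ρ_T, and either the first T entries sum to at
-- least a_T B or they have all been raised to ρ_T, whence c(λ, T) ≥ a_T; later
-- passes only increase λ.
--
-- For minimality let y be one resource of a sequence meeting the requirements;
-- then Σ_{t≤T} min(y_t, ρ_T) ≥ a_T B for all T.  Every step keeps each tail sum
-- Σ_{k<t≤τ₂} λ_t at most that of y.  Indeed, if entry t > k is really increased
-- in the pass for T, then λ_s ≥ ρ_T for all s ≤ k and Σ_{t≤T} λ_t stays at most
-- a_T B, so the part of the tail in (k, T] is at most a_T B − k ρ_T, hence at most
-- Σ_{k<t≤T} y_t; beyond T the bound is inherited.  With k = 0 this gives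
-- Σ λ_t ≤ Σ y_t ≤ B.

open import Algebra.Bundles using (CommutativeRing)
import Algebra.Construct.NaturalChoice.Max
import Algebra.Construct.NaturalChoice.MaxOp
import Algebra.Construct.NaturalChoice.Min
import Algebra.Construct.NaturalChoice.MinOp
import Algebra.Properties.Group
import Algebra.Properties.Monoid.Sum
import Algebra.Properties.Ring
import Algebra.Properties.Semiring.Sum
import Algebra.Solver.Ring.NaturalCoefficients.Default
open import Data.Bool.Base using (if_then_else_; true; false)
open import Data.Fin.Base using (Fin; zero; suc; toℕ; fromℕ<)
open import Data.Fin.Properties using (toℕ<n; toℕ-fromℕ; toℕ-inject₁; toℕ-fromℕ<)
open import Data.Nat.Base as ℕ using (ℕ; zero; suc; NonZero; z≤n; s≤s)
import Data.Nat.Properties as ℕ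
open import Data.Product.Base using (_×_; _,_; proj₁; proj₂; ∃-syntax)
open import Data.Sum.Base using (_⊎_; inj₁; inj₂)
open import Data.Vec.Functional using (Vector; tail)
open import Function.Bundles using (_⇔_; mk⇔)
open import Level using (Level; _⊔_)
open import Relation.Binary.Bundles using (TotalOrder)
open import Relation.Binary.PropositionalEquality as ≡ using (_≡_; _≢_)
import Relation.Binary.Reasoning.PartialOrder
open import Relation.Binary.Structures using (IsDecTotalOrder)
open import Relation.Nullary.Decidable using (does; yes; no; dec-true; dec-false)
open import Relation.Nullary.Negation.Core using (¬_; contradiction)
open import Defs

-- Order and division in an ordered field.

module OrderedFieldProperties {a ℓ₁ ℓ₂ : Level} (K : OrderedField a ℓ₁ ℓ₂) where
  open OrderedField K
  open CommutativeRing commutativeRing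
    using (ring; semiring; commutativeSemiring; +-group; +-cong; +-congˡ; +-congʳ;
           +-comm; +-assoc; +-identityˡ; +-identityʳ;
           *-cong; *-congˡ; *-congʳ; *-comm; *-assoc; *-identityˡ; *-identityʳ;
           zeroˡ; zeroʳ; distribʳ)
    renaming (refl to ≈-refl; sym to ≈-sym; trans to ≈-trans; reflexive to ≈-reflexive)
    public
  open IsDecTotalOrder isDecTotalOrder
    using (total)
    renaming (refl to ≤-refl; reflexive to ≤-reflexive; trans to ≤-trans;
              antisym to ≤-antisym; _≟_ to _≈?_; _≤?_ to _≤?_)
    public
  open Algebra.Construct.NaturalChoice.MinOp
    (Algebra.Construct.NaturalChoice.Min.minOperator totalOrder)
    using (x⊓y≤x; x⊓y≤y; ⊓-glb; ⊓-sel; ⊓-cong; ⊓-mono-≤; mono-≤-distrib-⊓) public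
  open Algebra.Construct.NaturalChoice.MaxOp
    (Algebra.Construct.NaturalChoice.Max.maxOperator totalOrder)
    using (x≤x⊔y; x≤y⊔x; ⊔-sel; ⊔-cong; mono-≤-distrib-⊔) public
  open Algebra.Properties.Group +-group
    using (//-cong₂; //-rightDividesˡ; //-rightDividesʳ; ⁻¹-involutive)
  open Algebra.Properties.Ring ring using (-1*x≈-x; [y-z]x≈yx-zx)
  open Algebra.Properties.Semiring.Sum semiring using (*-distribʳ-sum)
  open Algebra.Properties.Monoid.Sum +-monoid using (sum-cong-≋; sum-init-last)
  open Algebra.Solver.Ring.NaturalCoefficients.Default commutativeSemiring
    using (solve; _:=_; _:+_)
  module ≤-Reasoning = Relation.Binary.Reasoning.PartialOrder (TotalOrder.poset totalOrder)
  open ≤-Reasoning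

  <⇒≤ : ∀ {x y} → x < y → x ≤ y
  <⇒≤ = proj₁

  >⇒≉0 : ∀ {x} → 0# < x → ¬ (x ≈ 0#)
  >⇒≉0 (_ , 0≉x) x≈0 = 0≉x (≈-sym x≈0)

  <-≤-trans : ∀ {x y z} → x < y → y ≤ z → x < z
  <-≤-trans {x} {y} {z} x<y y≤z = begin-strict x <⟨ x<y ⟩ y ≤⟨ y≤z ⟩ z ∎

  <⇒≱ : ∀ {x y} → x < y → ¬ (y ≤ x)
  <⇒≱ (x≤y , x≉y) y≤x = x≉y (≤-antisym x≤y y≤x)

  ≰⇒> : ∀ {x y} → ¬ (x ≤ y) → y < x
  ≰⇒> {x} {y} x≰y with total x y
  ... | inj₁ x≤y = contradiction x≤y x≰y
  ... | inj₂ y≤x = y≤x , λ y≈x → x≰y (≤-reflexive (≈-sym y≈x))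

  +-monoˡ-≤ : ∀ z {x y} → x ≤ y → x + z ≤ y + z
  +-monoˡ-≤ z {x} {y} x≤y = begin
    x + z ≈⟨ +-comm x z ⟩
    z + x ≤⟨ +-monoʳ-≤ z x≤y ⟩
    z + y ≈⟨ +-comm z y ⟩
    y + z ∎

  +-mono-≤ : ∀ {w x y z} → w ≤ x → y ≤ z → w + y ≤ x + z
  +-mono-≤ w≤x y≤z = ≤-trans (+-monoˡ-≤ _ w≤x) (+-monoʳ-≤ _ y≤z)

  x-y+y≈x : ∀ x y → x - y + y ≈ x
  x-y+y≈x x y = //-rightDividesˡ y x

  +-cancelʳ-≤ : ∀ z {x y} → x + z ≤ y + z → x ≤ y
  +-cancelʳ-≤ z {x} {y} x+z≤y+z = begin
    x           ≈⟨ //-rightDividesʳ z x ⟨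
    x + z - z   ≤⟨ +-monoˡ-≤ (- z) x+z≤y+z ⟩
    y + z - z   ≈⟨ //-rightDividesʳ z y ⟩
    y           ∎

  x≤y⇒0≤y-x : ∀ {x y} → x ≤ y → 0# ≤ y - x
  x≤y⇒0≤y-x {x} {y} x≤y = +-cancelʳ-≤ x (begin
    0# + x    ≈⟨ +-identityˡ x ⟩
    x         ≤⟨ x≤y ⟩
    y         ≈⟨ x-y+y≈x y x ⟨
    y - x + x ∎)

  x≤x+y : ∀ {x y} → 0# ≤ y → x ≤ x + y
  x≤x+y {x} {y} 0≤y = begin
    x      ≈⟨ +-identityʳ x ⟨
    x + 0# ≤⟨ +-monoʳ-≤ x 0≤y ⟩
    x + y  ∎

  *-monoˡ-≤ : ∀ {z} → 0# ≤ z → ∀ {x y} → x ≤ y → x * z ≤ y * z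
  *-monoˡ-≤ {z} 0≤z {x} {y} x≤y = begin
    x * z               ≤⟨ x≤x+y (*-nonNegative (x≤y⇒0≤y-x x≤y) 0≤z) ⟩
    x * z + (y - x) * z ≈⟨ +-congˡ ([y-z]x≈yx-zx z y x) ⟩
    x * z + (y * z - x * z) ≈⟨ +-comm _ _ ⟩
    y * z - x * z + x * z ≈⟨ x-y+y≈x (y * z) (x * z) ⟩
    y * z ∎

  *-monoʳ-≤ : ∀ {z} → 0# ≤ z → ∀ {x y} → x ≤ y → z * x ≤ z * y
  *-monoʳ-≤ {z} 0≤z {x} {y} x≤y = begin
    z * x ≈⟨ *-comm z x ⟩
    x * z ≤⟨ *-monoˡ-≤ 0≤z x≤y ⟩
    y * z ≈⟨ *-comm y z ⟩
    z * y ∎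

  -- Were `1#` at most `0#`, then `- 1#` would be nonnegative and so would its square, which is
  -- `1#`; antisymmetry would identify `0#` with `1#`.
  0<1 : 0# < 1#
  0<1 = ≰⇒> λ 1≤0 → 0≉1 (≤-antisym (0≤1 (x≤y⇒0≤y-x 1≤0)) 1≤0)
    where
    0≤1 : 0# ≤ 0# - 1# → 0# ≤ 1#
    0≤1 0≤-1 = begin
      0#                      ≤⟨ *-nonNegative 0≤-1 0≤-1 ⟩
      (0# - 1#) * (0# - 1#)   ≈⟨ *-cong (+-identityˡ _) (+-identityˡ _) ⟩
      - 1# * - 1#             ≈⟨ -1*x≈-x _ ⟩
      - - 1#                  ≈⟨ ⁻¹-involutive 1# ⟩
      1#                      ∎

  0≤⁻¹ : ∀ {x} → 0# < x → 0# ≤ x ⁻¹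
  0≤⁻¹ {x} 0<x with total 0# (x ⁻¹)
  ... | inj₁ 0≤x⁻¹ = 0≤x⁻¹
  ... | inj₂ x⁻¹≤0 = contradiction (begin
    1#       ≈⟨ *-inverseʳ x (>⇒≉0 0<x) ⟨
    x * x ⁻¹ ≤⟨ *-monoʳ-≤ (<⇒≤ 0<x) x⁻¹≤0 ⟩
    x * 0#   ≈⟨ zeroʳ x ⟩
    0#       ∎) (<⇒≱ 0<1)

  x*y÷y≈x : ∀ x {y} → 0# < y → x * y ÷ y ≈ x
  x*y÷y≈x x {y} 0<y = begin-equality
    x * y * y ⁻¹   ≈⟨ *-assoc x y _ ⟩
    x * (y * y ⁻¹) ≈⟨ *-congˡ (*-inverseʳ y (>⇒≉0 0<y)) ⟩
    x * 1#         ≈⟨ *-identityʳ x ⟩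
    x              ∎

  x÷y*y≈x : ∀ x {y} → 0# < y → x ÷ y * y ≈ x
  x÷y*y≈x x {y} 0<y = begin-equality
    x * y ⁻¹ * y   ≈⟨ *-assoc x _ y ⟩
    x * (y ⁻¹ * y) ≈⟨ *-congˡ (*-comm _ y) ⟩
    x * (y * y ⁻¹) ≈⟨ *-assoc x y _ ⟨
    x * y * y ⁻¹   ≈⟨ x*y÷y≈x x 0<y ⟩
    x              ∎

  *-cancelʳ-≤ : ∀ {z} → 0# < z → ∀ {x y} → x * z ≤ y * z → x ≤ y
  *-cancelʳ-≤ {z} 0<z {x} {y} xz≤yz = begin
    x         ≈⟨ x*y÷y≈x x 0<z ⟨
    x * z ÷ z ≤⟨ *-monoˡ-≤ (0≤⁻¹ 0<z) xz≤yz ⟩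
    y * z ÷ z ≈⟨ x*y÷y≈x y 0<z ⟩
    y         ∎

  *-positive : ∀ {x y} → 0# < x → 0# < y → 0# < x * y
  *-positive {x} {y} 0<x 0<y = ≰⇒> λ xy≤0 → <⇒≱ 0<x (*-cancelʳ-≤ 0<y (begin
    x * y  ≤⟨ xy≤0 ⟩
    0#     ≈⟨ zeroˡ y ⟨
    0# * y ∎))

  0<⁻¹ : ∀ {x} → 0# < x → 0# < x ⁻¹
  0<⁻¹ {x} 0<x = 0≤⁻¹ 0<x , λ 0≈x⁻¹ → 0≉1 (begin-equality
    0#       ≈⟨ zeroʳ x ⟨
    x * 0#   ≈⟨ *-congˡ 0≈x⁻¹ ⟩
    x * x ⁻¹ ≈⟨ *-inverseʳ x (>⇒≉0 0<x) ⟩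
    1#       ∎)

  ÷-cross : ∀ {w x y z} → 0# < x → 0# < z → w * z ≈ y * x → w ÷ x ≈ y ÷ z
  ÷-cross {w} {x} {y} {z} 0<x 0<z wz≈yx = begin-equality
    w ÷ x              ≈⟨ *-congʳ (x*y÷y≈x w 0<z) ⟨
    w * z ÷ z ÷ x      ≈⟨ *-congʳ (*-congʳ wz≈yx) ⟩
    y * x ÷ z ÷ x      ≈⟨ *-assoc _ _ _ ⟩
    y * x * (z ⁻¹ * x ⁻¹) ≈⟨ *-congˡ (*-comm _ _) ⟩
    y * x * (x ⁻¹ * z ⁻¹) ≈⟨ *-assoc _ _ _ ⟨
    y * x ÷ x ÷ z      ≈⟨ *-congʳ (x*y÷y≈x y 0<x) ⟩
    y ÷ z              ∎

  -- Embedded natural numbers and finite sums.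

  0≤fromℕ : ∀ n → 0# ≤ fromℕ n
  0≤fromℕ zero    = ≤-refl
  0≤fromℕ (suc n) = ≤-trans (<⇒≤ 0<1) (x≤x+y (0≤fromℕ n))

  0<fromℕ : ∀ {n} → 1 ℕ.≤ n → 0# < fromℕ n
  0<fromℕ {suc n} _ = <-≤-trans 0<1 (x≤x+y (0≤fromℕ n))

  fromℕ-mono-≤ : ∀ {m n} → m ℕ.≤ n → fromℕ m ≤ fromℕ n
  fromℕ-mono-≤ {n = n} z≤n = 0≤fromℕ n
  fromℕ-mono-≤ (s≤s m≤n)   = +-monoʳ-≤ 1# (fromℕ-mono-≤ m≤n)

  Σ₁-suc : ∀ n f → Σ₁ (suc n) f ≈ Σ₁ n f + f (suc n)
  Σ₁-suc n f = ≈-trans (sum-init-last {n} (λ i → f (suc (toℕ i))))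
    (+-cong (sum-cong-≋ {n} λ i → ≈-reflexive (≡.cong (λ k → f (suc k)) (toℕ-inject₁ i)))
            (≈-reflexive (≡.cong (λ k → f (suc k)) (toℕ-fromℕ n))))

  Σ₁-mono-≤ : ∀ n {f g} → (∀ s → 1 ℕ.≤ s → s ℕ.≤ n → f s ≤ g s) → Σ₁ n f ≤ Σ₁ n g
  Σ₁-mono-≤ zero    f≤g = ≤-refl
  Σ₁-mono-≤ (suc n) {f} {g} f≤g = begin
    Σ₁ (suc n) f       ≈⟨ Σ₁-suc n f ⟩
    Σ₁ n f + f (suc n) ≤⟨ +-mono-≤ (Σ₁-mono-≤ n λ s 1≤s s≤n → f≤g s 1≤s (ℕ.m≤n⇒m≤1+n s≤n))
                                   (f≤g (suc n) (s≤s z≤n) ℕ.≤-refl) ⟩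
    Σ₁ n g + g (suc n) ≈⟨ Σ₁-suc n g ⟨
    Σ₁ (suc n) g       ∎

  Σ₁-cong : ∀ n {f g} → (∀ s → 1 ℕ.≤ s → s ℕ.≤ n → f s ≈ g s) → Σ₁ n f ≈ Σ₁ n g
  Σ₁-cong n f≈g = ≤-antisym
    (Σ₁-mono-≤ n λ s 1≤s s≤n → ≤-reflexive (f≈g s 1≤s s≤n))
    (Σ₁-mono-≤ n λ s 1≤s s≤n → ≤-reflexive (≈-sym (f≈g s 1≤s s≤n)))

  Σ₁-*-distribʳ : ∀ n f x → Σ₁ n f * x ≈ Σ₁ n (λ s → f s * x)
  Σ₁-*-distribʳ n f x = *-distribʳ-sum {n} x (λ i → f (suc (toℕ i)))

  Σ₁-const : ∀ n x → Σ₁ n (λ _ → x) ≈ fromℕ n * x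
  Σ₁-const zero    x = ≈-sym (zeroˡ x)
  Σ₁-const (suc n) x = begin-equality
    x + Σ₁ n (λ _ → x)  ≈⟨ +-cong (≈-sym (*-identityˡ x)) (Σ₁-const n x) ⟩
    1# * x + fromℕ n * x ≈⟨ distribʳ x 1# (fromℕ n) ⟨
    fromℕ (suc n) * x ∎

  Σ₁-nonPositive : ∀ n {f} → (∀ s → f s ≤ 0#) → Σ₁ n f ≤ 0#
  Σ₁-nonPositive n {f} f≤0 = begin
    Σ₁ n f           ≤⟨ Σ₁-mono-≤ n (λ s _ _ → f≤0 s) ⟩
    Σ₁ n (λ _ → 0#)  ≈⟨ Σ₁-const n 0# ⟩
    fromℕ n * 0#     ≈⟨ zeroʳ _ ⟩
    0#               ∎

  Σ₁-nonNegative : ∀ n {f} → (∀ s → 1 ℕ.≤ s → s ℕ.≤ n → 0# ≤ f s) → 0# ≤ Σ₁ n f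
  Σ₁-nonNegative n {f} 0≤f = begin
    0#               ≈⟨ zeroʳ _ ⟨
    fromℕ n * 0#     ≈⟨ Σ₁-const n 0# ⟨
    Σ₁ n (λ _ → 0#)  ≤⟨ Σ₁-mono-≤ n 0≤f ⟩
    Σ₁ n f           ∎

  module _ {f g : ℕ → Carrier} {t : ℕ} {d : Carrier}
           (gt≈ft+d : g t ≈ f t + d) (g≈f : ∀ s → s ≢ t → g s ≈ f s) where

    Σ₁-perturb-< : ∀ {n} → n ℕ.< t → Σ₁ n g ≈ Σ₁ n f
    Σ₁-perturb-< {n} n<t =
      Σ₁-cong n λ s _ s≤n → g≈f s (ℕ.<⇒≢ (ℕ.≤-<-trans s≤n n<t))

    -- Here `g` is `f` with the single entry `t` raised by `d`, as after one run of `update`.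
    -- Recursion on `n` peels off last terms until `t` itself is last; the prefix below it is
    -- untouched.
    Σ₁-perturb : ∀ {n} → 1 ℕ.≤ t → t ℕ.≤ n → Σ₁ n g ≈ Σ₁ n f + d
    Σ₁-perturb {zero}  1≤t t≤0 = contradiction (ℕ.≤-trans 1≤t t≤0) λ ()
    Σ₁-perturb {suc n} 1≤t t≤1+n with suc n ℕ.≟ t
    ... | yes ≡.refl = begin-equality
      Σ₁ (suc n) g             ≈⟨ Σ₁-suc n g ⟩
      Σ₁ n g + g (suc n)       ≈⟨ +-cong (Σ₁-perturb-< ℕ.≤-refl) gt≈ft+d ⟩
      Σ₁ n f + (f (suc n) + d) ≈⟨ +-assoc _ _ _ ⟨
      Σ₁ n f + f (suc n) + d   ≈⟨ +-congʳ (Σ₁-suc n f) ⟨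
      Σ₁ (suc n) f + d         ∎
    ... | no 1+n≢t = begin-equality
      Σ₁ (suc n) g             ≈⟨ Σ₁-suc n g ⟩
      Σ₁ n g + g (suc n)       ≈⟨ +-cong (Σ₁-perturb 1≤t t≤n) (g≈f (suc n) 1+n≢t) ⟩
      Σ₁ n f + d + f (suc n)   ≈⟨ solve 3 (λ x y z → x :+ y :+ z := x :+ z :+ y) ≈-refl _ _ _ ⟩
      Σ₁ n f + f (suc n) + d   ≈⟨ +-congʳ (Σ₁-suc n f) ⟨
      Σ₁ (suc n) f + d         ∎
      where
      t≤n : t ℕ.≤ n
      t≤n = ℕ.≤-pred (ℕ.≤∧≢⇒< t≤1+n λ t≡1+n → 1+n≢t (≡.sym t≡1+n))

  -- Minima of vectors and over ranges.

  minimum-≤ : ∀ {n} .{{_ : NonZero n}} (v : Vector Carrier n) i → minimum v ≤ v i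
  minimum-≤ {suc zero}    v zero    = ≤-refl
  minimum-≤ {suc (suc n)} v zero    = x⊓y≤x _ _
  minimum-≤ {suc (suc n)} v (suc i) = ≤-trans (x⊓y≤y _ _) (minimum-≤ (tail v) i)

  ≤-minimum : ∀ {n} .{{_ : NonZero n}} (v : Vector Carrier n) {x} →
              (∀ i → x ≤ v i) → x ≤ minimum v
  ≤-minimum {suc zero}    v x≤v = x≤v zero
  ≤-minimum {suc (suc n)} v x≤v = ⊓-glb (x≤v zero) (≤-minimum (tail v) λ i → x≤v (suc i))

  minimum-mono-≤ : ∀ {n} .{{_ : NonZero n}} (v w : Vector Carrier n) →
                   (∀ i → v i ≤ w i) → minimum v ≤ minimum w
  minimum-mono-≤ v w v≤w = ≤-minimum w λ i → ≤-trans (minimum-≤ v i) (v≤w i)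

  minRange-≤ : ∀ {k l n} f → k ℕ.≤ n → n ℕ.≤ l → minRange k l f ≤ f n
  minRange-≤ {k} {l} {n} f k≤n n≤l = begin
    minRange k l f    ≤⟨ minimum-≤ _ i ⟩
    f (k ℕ.+ toℕ i)   ≡⟨ ≡.cong f k+i≡n ⟩
    f n               ∎
    where
    -- The entry for `n` has offset `n ∸ k`, which is at most `l ∸ k` and hence below the length
    -- `suc (l ∸ k)`.
    i = fromℕ< (s≤s (ℕ.∸-monoˡ-≤ k n≤l))
    k+i≡n : k ℕ.+ toℕ i ≡ n
    k+i≡n = ≡.trans (≡.cong (k ℕ.+_) (toℕ-fromℕ< _)) (ℕ.m+[n∸m]≡n k≤n)

  ≤-minRange : ∀ {k l} f {x} → k ℕ.≤ l →
               (∀ n → k ℕ.≤ n → n ℕ.≤ l → x ≤ f n) → x ≤ minRange k l f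
  ≤-minRange {k} {l} f k≤l x≤f = ≤-minimum {suc (l ℕ.∸ k)} _ λ i →
    x≤f (k ℕ.+ toℕ i) (ℕ.m≤m+n k _)
      (ℕ.≤-trans (ℕ.+-monoʳ-≤ k (ℕ.≤-pred (toℕ<n i))) (ℕ.≤-reflexive (ℕ.m+[n∸m]≡n k≤l)))

  -- The amount added by one step of the algorithm.

  increment : (r x v s : Carrier) → Carrier
  increment r x v s = ((r - x) ⊓ (v - s)) ⁺

  0≤increment : ∀ r x v s → 0# ≤ increment r x v s
  0≤increment r x v s = x≤y⊔x _ 0#

  x≤y-z⇒z+x≤y : ∀ {x y z} → x ≤ y - z → z + x ≤ y
  x≤y-z⇒z+x≤y {x} {y} {z} x≤y-z = begin
    z + x     ≤⟨ +-monoʳ-≤ z x≤y-z ⟩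
    z + (y - z) ≈⟨ +-comm _ _ ⟩
    y - z + z ≈⟨ x-y+y≈x y z ⟩
    y         ∎

  y-z≤x⇒y≤z+x : ∀ {x y z} → y - z ≤ x → y ≤ z + x
  y-z≤x⇒y≤z+x {x} {y} {z} y-z≤x = begin
    y         ≈⟨ x-y+y≈x y z ⟨
    y - z + z ≈⟨ +-comm _ _ ⟩
    z + (y - z) ≤⟨ +-monoʳ-≤ z y-z≤x ⟩
    z + x     ∎

  -- In the algorithm `r` is the cap `ρ T j`, `x` the current entry, `v` the goal `α * B j` and `s`
  -- the sum of the first `T` entries. The positive part is either `0#` or the minimum itself, and
  -- in the second case both bounds on the minimum apply. The zero case promises no bounds, since
  -- cap or goal may already be exceeded.
  increment-upper : ∀ r x v s → let d = increment r x v s in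
                    d ≈ 0# ⊎ (x + d ≤ r × s + d ≤ v)
  increment-upper r x v s with ⊔-sel ((r - x) ⊓ (v - s)) 0#
  ... | inj₁ d≈min = inj₂
    ( x≤y-z⇒z+x≤y (≤-trans (≤-reflexive d≈min) (x⊓y≤x _ _))
    , x≤y-z⇒z+x≤y (≤-trans (≤-reflexive d≈min) (x⊓y≤y _ _)))
  ... | inj₂ d≈0 = inj₁ d≈0

  -- The increment is at least the minimum, which equals one of its two arguments; so every step
  -- reaches the cap or the goal.
  increment-lower : ∀ r x v s → let d = increment r x v s in
                    r ≤ x + d ⊎ v ≤ s + d
  increment-lower r x v s with ⊓-sel (r - x) (v - s)
  ... | inj₁ min≈ = inj₁ (y-z≤x⇒y≤z+x (≤-trans (≤-reflexive (≈-sym min≈)) (x≤x⊔y _ 0#)))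
  ... | inj₂ min≈ = inj₂ (y-z≤x⇒y≤z+x (≤-trans (≤-reflexive (≈-sym min≈)) (x≤x⊔y _ 0#)))

  increment≈0 : ∀ r x v s → v ≤ s → increment r x v s ≈ 0#
  increment≈0 r x v s v≤s with increment-upper r x v s
  ... | inj₁ d≈0 = d≈0
  ... | inj₂ (_ , s+d≤v) = ≤-antisym (+-cancelʳ-≤ s (begin
      increment r x v s + s ≈⟨ +-comm _ _ ⟩
      s + increment r x v s ≤⟨ s+d≤v ⟩
      v                     ≤⟨ v≤s ⟩
      s                     ≈⟨ +-identityˡ s ⟨
      0# + s                ∎)) (0≤increment r x v s)

  +-increment-≤ : ∀ {r x} v s → x ≤ r → x + increment r x v s ≤ r
  +-increment-≤ {r} {x} v s x≤r with increment-upper r x v s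
  ... | inj₁ d≈0 = ≤-trans (≤-reflexive (≈-trans (+-congˡ d≈0) (+-identityʳ x))) x≤r
  ... | inj₂ (x+d≤r , _) = x+d≤r

  -- Multiplication by a nonnegative factor is monotone, hence commutes with minimum and maximum.
  -- This homogeneity is what preserves proportionality to `B`.
  increment-*-distribʳ : ∀ r x v s {p} → 0# ≤ p →
    increment r x v s * p ≈ increment (r * p) (x * p) (v * p) (s * p)
  increment-*-distribʳ r x v s {p} 0≤p = begin-equality
    increment r x v s * p
      ≈⟨ mono-≤-distrib-⊔ {f = _* p} *-congʳ (*-monoˡ-≤ 0≤p) _ _ ⟩
    (((r - x) ⊓ (v - s)) * p) ⊔′ (0# * p)
      ≈⟨ ⊔-cong (mono-≤-distrib-⊓ {f = _* p} *-congʳ (*-monoˡ-≤ 0≤p) _ _) (zeroˡ p) ⟩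
    (((r - x) * p) ⊓ ((v - s) * p)) ⁺
      ≈⟨ ⊔-cong (⊓-cong ([y-z]x≈yx-zx p r x) ([y-z]x≈yx-zx p v s)) ≈-refl ⟩
    increment (r * p) (x * p) (v * p) (s * p) ∎

  increment-cong : ∀ {r r′ x x′ v v′ s s′} → r ≈ r′ → x ≈ x′ → v ≈ v′ → s ≈ s′ →
                   increment r x v s ≈ increment r′ x′ v′ s′
  increment-cong r x v s = ⊔-cong (⊓-cong (//-cong₂ r x) (//-cong₂ v s)) ≈-refl

  -- Comparison of tail sums.

  -- Every tail Σ_{k<t≤N} f t is at most Σ_{k<t≤N} g t, written without subtraction.
  TailsDominated : ℕ → (f g : ℕ → Carrier) → Set ℓ₂
  TailsDominated N f g = ∀ {k} → k ℕ.≤ N → Σ₁ N f + Σ₁ k g ≤ Σ₁ N g + Σ₁ k f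

  -- Induction from `k` up to `n`: at `n = k` both sides agree, and each later index contributes no
  -- more on the left than on the right.
  pointwise⇒tails : ∀ n {f g} → (∀ s → 1 ℕ.≤ s → s ℕ.≤ n → f s ≤ g s) →
                    TailsDominated n f g
  pointwise⇒tails n {f} {g} f≤g {k} k≤n with n ℕ.≟ k
  ... | yes ≡.refl = ≤-reflexive (+-comm _ _)
  pointwise⇒tails zero    f≤g {zero} z≤n | no 0≢0 = contradiction ≡.refl 0≢0
  pointwise⇒tails (suc n) {f} {g} f≤g {k} k≤1+n | no 1+n≢k = begin
    Σ₁ (suc n) f + Σ₁ k g         ≈⟨ +-congʳ (Σ₁-suc n f) ⟩
    Σ₁ n f + f (suc n) + Σ₁ k g   ≈⟨ swap _ _ _ ⟩
    Σ₁ n f + Σ₁ k g + f (suc n)   ≤⟨ +-mono-≤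
      (pointwise⇒tails n (λ s 1≤s s≤n → f≤g s 1≤s (ℕ.m≤n⇒m≤1+n s≤n))
        (ℕ.≤-pred (ℕ.≤∧≢⇒< k≤1+n λ k≡1+n → 1+n≢k (≡.sym k≡1+n))))
      (f≤g (suc n) (s≤s z≤n) ℕ.≤-refl) ⟩
    Σ₁ n g + Σ₁ k f + g (suc n)   ≈⟨ swap _ _ _ ⟩
    Σ₁ n g + g (suc n) + Σ₁ k f   ≈⟨ +-congʳ (Σ₁-suc n g) ⟨
    Σ₁ (suc n) g + Σ₁ k f         ∎
    where
    swap : ∀ x y z → x + y + z ≈ x + z + y
    swap = solve 3 (λ x y z → x :+ y :+ z := x :+ z :+ y) ≈-refl

  -- If `t ≤ k`, both `Σ₁ N` and `Σ₁ k` of the raised sequence gain `d`, so the inequality keeps its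
  -- slack. If `k < t`, only `Σ₁ N` gains `d`: either `d` vanishes, or the entries up to `k` are at
  -- least `r` and the goal `v` bounds the new sum up to `T`.
  tails-step : ∀ {N T t x x′ y d r v} → T ℕ.≤ N → 1 ℕ.≤ t → t ℕ.≤ T →
    x′ t ≈ x t + d → (∀ s → s ≢ t → x′ s ≈ x s) →
    d ≈ 0# ⊎ (Σ₁ T x + d ≤ v × (∀ s → 1 ℕ.≤ s → s ℕ.< t → r ≤ x s)) →
    v ≤ Σ₁ T (λ s → y s ⊓ r) →
    TailsDominated N x y → TailsDominated N x′ y
  tails-step {N} {T} {t} {x} {x′} {y} {d} {r} {v} T≤N 1≤t t≤T x′t≈ x′≈ alt v≤ΣTm dom {k} k≤N
    with t ℕ.≤? k | alt
  ... | yes t≤k | _ = begin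
    Σ₁ N x′ + Σ₁ k y    ≈⟨ +-congʳ (Σ₁-perturb x′t≈ x′≈ 1≤t (ℕ.≤-trans t≤T T≤N)) ⟩
    Σ₁ N x + d + Σ₁ k y ≈⟨ solve 3 (λ u v w → u :+ v :+ w := u :+ w :+ v) ≈-refl _ _ _ ⟩
    Σ₁ N x + Σ₁ k y + d ≤⟨ +-monoˡ-≤ d (dom k≤N) ⟩
    Σ₁ N y + Σ₁ k x + d ≈⟨ +-assoc _ _ _ ⟩
    Σ₁ N y + (Σ₁ k x + d) ≈⟨ +-congˡ (Σ₁-perturb x′t≈ x′≈ 1≤t t≤k) ⟨
    Σ₁ N y + Σ₁ k x′    ∎
  ... | no t≰k | inj₁ d≈0 = begin
    Σ₁ N x′ + Σ₁ k y    ≈⟨ +-congʳ (Σ₁-perturb x′t≈ x′≈ 1≤t (ℕ.≤-trans t≤T T≤N)) ⟩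
    Σ₁ N x + d + Σ₁ k y ≈⟨ +-congʳ (≈-trans (+-congˡ d≈0) (+-identityʳ _)) ⟩
    Σ₁ N x + Σ₁ k y     ≤⟨ dom k≤N ⟩
    Σ₁ N y + Σ₁ k x     ≈⟨ +-congˡ (Σ₁-perturb-< x′t≈ x′≈ (ℕ.≰⇒> t≰k)) ⟨
    Σ₁ N y + Σ₁ k x′    ∎
  ... | no t≰k | inj₂ (ΣTx+d≤v , r≤x) = begin
    Σ₁ N x′ + Σ₁ k y    ≈⟨ +-congʳ (Σ₁-perturb x′t≈ x′≈ 1≤t (ℕ.≤-trans t≤T T≤N)) ⟩
    Σ₁ N x + d + Σ₁ k y ≤⟨ +-cancelʳ-≤ (Σ₁ T y + Σ₁ T x + Σ₁ T m + Σ₁ k m) summed ⟩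
    Σ₁ N y + Σ₁ k x     ≈⟨ +-congˡ (Σ₁-perturb-< x′t≈ x′≈ k<t) ⟨
    Σ₁ N y + Σ₁ k x′    ∎
    where
    k<t = ℕ.≰⇒> t≰k
    m : ℕ → Carrier
    m s = y s ⊓ r

    -- Four inequalities are added: dominance of the tail beyond `T`; `Σ₁ T x + d ≤ v ≤ Σ₁ T m`; the
    -- tail of `m` in `(k, T]` is at most that of `y`; and `m ≤ r ≤ x` on the first `k` entries. The
    -- common summand collects what appears on both sides, so it can be cancelled without
    -- subtraction.
    summed : Σ₁ N x + d + Σ₁ k y + (Σ₁ T y + Σ₁ T x + Σ₁ T m + Σ₁ k m)
           ≤ Σ₁ N y + Σ₁ k x + (Σ₁ T y + Σ₁ T x + Σ₁ T m + Σ₁ k m)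
    summed = begin
      Σ₁ N x + d + Σ₁ k y + (Σ₁ T y + Σ₁ T x + Σ₁ T m + Σ₁ k m)
        ≈⟨ solve 7 (λ X d yk yT xT mT mk →
             X :+ d :+ yk :+ (yT :+ xT :+ mT :+ mk)
             := (X :+ yT) :+ (xT :+ d) :+ (mT :+ yk) :+ mk) ≈-refl _ _ _ _ _ _ _ ⟩
      (Σ₁ N x + Σ₁ T y) + (Σ₁ T x + d) + (Σ₁ T m + Σ₁ k y) + Σ₁ k m
        ≤⟨ +-mono-≤ (+-mono-≤ (+-mono-≤ (dom T≤N) (≤-trans ΣTx+d≤v v≤ΣTm))
             (pointwise⇒tails T {m} {y} (λ s _ _ → x⊓y≤x (y s) r) (ℕ.≤-trans (ℕ.<⇒≤ k<t) t≤T)))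
             (Σ₁-mono-≤ k λ s 1≤s s≤k →
               ≤-trans (x⊓y≤y (y s) r) (r≤x s 1≤s (ℕ.≤-<-trans s≤k k<t))) ⟩
      (Σ₁ N y + Σ₁ T x) + Σ₁ T m + (Σ₁ T y + Σ₁ k m) + Σ₁ k x
        ≈⟨ solve 6 (λ Y xk yT xT mT mk →
             (Y :+ xT) :+ mT :+ (yT :+ mk) :+ xk
             := Y :+ xk :+ (yT :+ xT :+ mT :+ mk)) ≈-refl _ _ _ _ _ _ ⟩
      Σ₁ N y + Σ₁ k x + (Σ₁ T y + Σ₁ T x + Σ₁ T m + Σ₁ k m) ∎

-- Consumption rates and the fraction `c`.

module ConsumptionProperties {a ℓ₁ ℓ₂ : Level} (K : OrderedField a ℓ₁ ℓ₂)
  {m : ℕ} .{{m≢0 : NonZero m}} (B : Vector (OrderedField.Carrier K) m)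
  (0<B : ∀ j → OrderedField._<_ K (OrderedField.0# K) (B j)) where
  open OrderedField K
  open OrderedFieldProperties K
  open Consumption K B
  open ≤-Reasoning

  someResource : Fin m
  someResource = fromℕ< (ℕ.>-nonZero⁻¹ m)

  column : Sequence → Fin m → ℕ → Carrier
  column lam j s = lam s j

  0<ρ : ∀ {T} → 1 ℕ.≤ T → ∀ j → 0# < ρ T j
  0<ρ 1≤T j = *-positive (0<B j) (0<⁻¹ (0<fromℕ 1≤T))

  fromℕ*ρ≈B : ∀ {T} → 1 ℕ.≤ T → ∀ j → fromℕ T * ρ T j ≈ B j
  fromℕ*ρ≈B {T} 1≤T j = begin-equality
    fromℕ T * ρ T j   ≈⟨ *-comm _ _ ⟩
    B j ÷ fromℕ T * fromℕ T ≈⟨ x÷y*y≈x (B j) (0<fromℕ 1≤T) ⟩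
    B j               ∎

  ρ-antitone : ∀ {T T′} → 1 ℕ.≤ T → T ℕ.≤ T′ → ∀ j → ρ T′ j ≤ ρ T j
  ρ-antitone {T} {T′} 1≤T T≤T′ j = *-cancelʳ-≤ (0<fromℕ 1≤T) (begin
    ρ T′ j * fromℕ T  ≈⟨ *-comm _ _ ⟩
    fromℕ T * ρ T′ j  ≤⟨ *-monoˡ-≤ (<⇒≤ (0<ρ 1≤T′ j)) (fromℕ-mono-≤ T≤T′) ⟩
    fromℕ T′ * ρ T′ j ≈⟨ fromℕ*ρ≈B 1≤T′ j ⟩
    B j               ≈⟨ fromℕ*ρ≈B 1≤T j ⟨
    fromℕ T * ρ T j   ≈⟨ *-comm _ _ ⟩
    ρ T j * fromℕ T   ∎)
    where 1≤T′ = ℕ.≤-trans 1≤T T≤T′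

  filledFraction : Sequence → ℕ → ℕ → Carrier
  filledFraction lam T t = minimum (λ j → lam t j ÷ ρ T j) ⊓ 1#

  -- The factor `fromℕ T ⁻¹` of `c` combines with `B j` to `ρ T j`. This translates bounds on `c`
  -- into bounds on sums of a single resource.
  c*B : ∀ lam T j → c lam T * B j ≈ Σ₁ T (λ t → filledFraction lam T t * ρ T j)
  c*B lam T j = begin-equality
    c lam T * B j ≈⟨ *-congʳ (*-comm _ _) ⟩
    Σ₁ T (filledFraction lam T) * fromℕ T ⁻¹ * B j ≈⟨ *-assoc _ _ _ ⟩
    Σ₁ T (filledFraction lam T) * (fromℕ T ⁻¹ * B j) ≈⟨ *-congˡ (*-comm _ _) ⟩
    Σ₁ T (filledFraction lam T) * ρ T j ≈⟨ Σ₁-*-distribʳ T (filledFraction lam T) (ρ T j) ⟩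
    Σ₁ T (λ t → filledFraction lam T t * ρ T j) ∎

  c-mono-≤ : ∀ {lam lam′ T} → 1 ℕ.≤ T → (∀ s j → lam s j ≤ lam′ s j) →
             c lam T ≤ c lam′ T
  c-mono-≤ {lam} {lam′} {T} 1≤T lam≤lam′ =
    *-monoʳ-≤ (0≤⁻¹ (0<fromℕ 1≤T)) (Σ₁-mono-≤ T λ s _ _ →
      ⊓-mono-≤ (minimum-mono-≤ _ _ λ j →
        *-monoˡ-≤ (0≤⁻¹ (0<ρ 1≤T j)) (lam≤lam′ s j)) (≤-refl {1#}))

  0≤c : ∀ {lam T} → 1 ℕ.≤ T → (∀ s j → 0# ≤ lam s j) → 0# ≤ c lam T
  0≤c {lam} {T} 1≤T 0≤lam =
    *-nonNegative (0≤⁻¹ (0<fromℕ 1≤T)) (Σ₁-nonNegative T λ s _ _ →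
      ⊓-glb (≤-minimum _ λ j → *-nonNegative (0≤lam s j) (0≤⁻¹ (0<ρ 1≤T j))) (<⇒≤ 0<1))

  -- Each summand of `c` is at most the ratio for resource `j` and at most `1#`; multiplied by
  -- `ρ T j`, these become the two arguments of the minimum. This is all that the minimality proof
  -- extracts from a bound on `c`.
  ≤c⇒*B≤Σ⊓ρ : ∀ {lam T α} → 1 ℕ.≤ T → α ≤ c lam T → ∀ j →
              α * B j ≤ Σ₁ T (λ s → lam s j ⊓ ρ T j)
  ≤c⇒*B≤Σ⊓ρ {lam} {T} {α} 1≤T α≤c j = begin
    α * B j       ≤⟨ *-monoˡ-≤ (<⇒≤ (0<B j)) α≤c ⟩
    c lam T * B j ≈⟨ c*B lam T j ⟩
    Σ₁ T (λ s → filledFraction lam T s * ρ T j)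
      ≤⟨ Σ₁-mono-≤ T (λ s _ _ → ⊓-glb (≤lam s) (≤ρ s)) ⟩
    Σ₁ T (λ s → lam s j ⊓ ρ T j) ∎
    where
    ≤lam : ∀ s → filledFraction lam T s * ρ T j ≤ lam s j
    ≤lam s = begin
      filledFraction lam T s * ρ T j
        ≤⟨ *-monoˡ-≤ (<⇒≤ (0<ρ 1≤T j)) (≤-trans (x⊓y≤x _ 1#) (minimum-≤ _ j)) ⟩
      lam s j ÷ ρ T j * ρ T j ≈⟨ x÷y*y≈x (lam s j) (0<ρ 1≤T j) ⟩
      lam s j                 ∎
    ≤ρ : ∀ s → filledFraction lam T s * ρ T j ≤ ρ T j
    ≤ρ s = begin
      filledFraction lam T s * ρ T j ≤⟨ *-monoˡ-≤ (<⇒≤ (0<ρ 1≤T j)) (x⊓y≤y _ 1#) ⟩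
      1# * ρ T j                     ≈⟨ *-identityˡ _ ⟩
      ρ T j                          ∎

  -- Under this bound every ratio in `c` is at most `1#`, so the truncation there loses nothing.
  Capped : ℕ → Sequence → Set ℓ₂
  Capped T lam = ∀ s j → lam s j ≤ ρ T j

  -- The ratio `lam s j ÷ B j` is independent of `j`, expressed by cross-multiplication.
  Proportional : Sequence → Set ℓ₁
  Proportional lam = ∀ s i j → lam s i * B j ≈ lam s j * B i

  -- Proportionality makes the inner minimum of c independent of the resource,
  -- so that a bound for one resource suffices.
  *B≤Σ⇒≤c : ∀ {lam T α} → 1 ℕ.≤ T → Capped T lam → Proportional lam →
            ∀ j → α * B j ≤ Σ₁ T (column lam j) → α ≤ c lam T
  *B≤Σ⇒≤c {lam} {T} {α} 1≤T cap prop j αB≤Σ = *-cancelʳ-≤ (0<B j) (begin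
    α * B j             ≤⟨ αB≤Σ ⟩
    Σ₁ T (column lam j) ≤⟨ Σ₁-mono-≤ T (λ s _ _ → lam≤ s) ⟩
    Σ₁ T (λ s → filledFraction lam T s * ρ T j) ≈⟨ c*B lam T j ⟨
    c lam T * B j       ∎)
    where
    same : ∀ s i → lam s j ÷ ρ T j ≈ lam s i ÷ ρ T i
    same s i = ÷-cross (0<ρ 1≤T j) (0<ρ 1≤T i) (begin-equality
      lam s j * ρ T i              ≈⟨ *-assoc _ _ _ ⟨
      lam s j * B i * fromℕ T ⁻¹   ≈⟨ *-congʳ (prop s j i) ⟩
      lam s i * B j * fromℕ T ⁻¹   ≈⟨ *-assoc _ _ _ ⟩
      lam s i * ρ T j              ∎)
    lam≤ : ∀ s → lam s j ≤ filledFraction lam T s * ρ T j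
    lam≤ s = begin
      lam s j                 ≈⟨ x÷y*y≈x (lam s j) (0<ρ 1≤T j) ⟨
      lam s j ÷ ρ T j * ρ T j ≤⟨ *-monoˡ-≤ (<⇒≤ (0<ρ 1≤T j))
        (⊓-glb (≤-minimum _ λ i → ≤-reflexive (same s i))
               (*-cancelʳ-≤ (0<ρ 1≤T j) (begin
                  lam s j ÷ ρ T j * ρ T j ≈⟨ x÷y*y≈x (lam s j) (0<ρ 1≤T j) ⟩
                  lam s j                 ≤⟨ cap s j ⟩
                  ρ T j                   ≈⟨ *-identityˡ _ ⟨
                  1# * ρ T j              ∎))) ⟩
      filledFraction lam T s * ρ T j ∎

  -- The inner loop: one pass for a fixed horizon.

  module _ (α : Carrier) (T : ℕ) where

    δ : ℕ → Sequence → Fin m → Carrier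
    δ t lam j = increment (ρ T j) (lam t j) (α * B j) (Σ₁ T (column lam j))

    update-≡ : ∀ t lam j → update α T t lam t j ≡ lam t j + δ t lam j
    update-≡ t lam j rewrite dec-true (t ℕ.≟ t) ≡.refl = ≡.refl

    update-≢ : ∀ {s t} → s ≢ t → ∀ lam j → update α T t lam s j ≡ lam s j
    update-≢ {s} {t} s≢t lam j rewrite dec-false (s ℕ.≟ t) s≢t = ≡.refl

    update-Σ : ∀ {t} → 1 ℕ.≤ t → t ℕ.≤ T → ∀ lam j →
      Σ₁ T (column (update α T t lam) j) ≈ Σ₁ T (column lam j) + δ t lam j
    update-Σ {t} 1≤t t≤T lam j = Σ₁-perturb {column lam j}
      (≈-reflexive (update-≡ t lam j)) (λ s s≢t → ≈-reflexive (update-≢ s≢t lam j)) 1≤t t≤T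

    update-elim : ∀ {p} (P : ℕ → (Fin m → Carrier) → Set p) t lam →
      P t (λ j → lam t j + δ t lam j) →
      (∀ s → s ≢ t → P s (lam s)) → ∀ s → P s (update α T t lam s)
    -- `does (s ≟ t)` reduces to `s ≡ᵇ t`; abstracting this boolean lets `update` compute in the
    -- goal, while the two conversions recover the propositional facts.
    update-elim P t lam Pt Ps s with s ℕ.≡ᵇ t | ℕ.≡ᵇ⇒≡ s t | ℕ.≡⇒≡ᵇ s t
    ... | true  | s≡t | _   with ≡.refl ← s≡t _ = Pt
    ... | false | _   | s≢t = Ps s s≢t

    ≤-update : ∀ t lam s j → lam s j ≤ update α T t lam s j
    ≤-update t lam s j = update-elim (λ s v → lam s j ≤ v j) t lam
      (x≤x+y (0≤increment _ _ _ _)) (λ _ _ → ≤-refl) s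

    ≤-innerLoop : ∀ n lam s j → lam s j ≤ innerLoop α T n lam s j
    ≤-innerLoop zero    lam s j = ≤-refl
    ≤-innerLoop (suc n) lam s j =
      ≤-trans (≤-innerLoop n lam s j) (≤-update (suc n) (innerLoop α T n lam) s j)

    innerLoop-capped : ∀ n {lam} → Capped T lam → Capped T (innerLoop α T n lam)
    innerLoop-capped zero    cap = cap
    innerLoop-capped (suc n) {lam} cap = update-elim (λ s v → ∀ j → v j ≤ ρ T j)
      (suc n) (innerLoop α T n lam) (λ j → +-increment-≤ _ _ (ih (suc n) j)) (λ s _ → ih s)
      where ih = innerLoop-capped n cap

    -- The cap, the entry, the goal and the running sum all scale with `B` across resources, and the
    -- increment is homogeneous in these four.
    innerLoop-proportional : ∀ n {lam} → Proportional lam →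
                             Proportional (innerLoop α T n lam)
    innerLoop-proportional zero    prop = prop
    innerLoop-proportional (suc n) {lam} prop =
      update-elim (λ s v → ∀ i j → v i * B j ≈ v j * B i) t lam′ (λ i j → begin-equality
        (lam′ t i + δ t lam′ i) * B j           ≈⟨ distribʳ _ _ _ ⟩
        lam′ t i * B j + δ t lam′ i * B j       ≈⟨ +-cong (ih t i j) (δ-proportional i j) ⟩
        lam′ t j * B i + δ t lam′ j * B i       ≈⟨ distribʳ _ _ _ ⟨
        (lam′ t j + δ t lam′ j) * B i           ∎) (λ s _ → ih s)
      where
      t = suc n
      lam′ = innerLoop α T n lam
      ih = innerLoop-proportional n prop

      ρ-proportional : ∀ i j → ρ T i * B j ≈ ρ T j * B i
      ρ-proportional i j = begin-equality
        B i * fromℕ T ⁻¹ * B j   ≈⟨ *-comm _ _ ⟩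
        B j * (B i * fromℕ T ⁻¹) ≈⟨ *-congˡ (*-comm _ _) ⟩
        B j * (fromℕ T ⁻¹ * B i) ≈⟨ *-assoc _ _ _ ⟨
        ρ T j * B i              ∎

      αB-proportional : ∀ i j → α * B i * B j ≈ α * B j * B i
      αB-proportional i j = begin-equality
        α * B i * B j   ≈⟨ *-assoc _ _ _ ⟩
        α * (B i * B j) ≈⟨ *-congˡ (*-comm _ _) ⟩
        α * (B j * B i) ≈⟨ *-assoc _ _ _ ⟨
        α * B j * B i   ∎

      Σ-proportional : ∀ i j → Σ₁ T (column lam′ i) * B j ≈ Σ₁ T (column lam′ j) * B i
      Σ-proportional i j = begin-equality
        Σ₁ T (column lam′ i) * B j     ≈⟨ Σ₁-*-distribʳ T (column lam′ i) (B j) ⟩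
        Σ₁ T (λ s → lam′ s i * B j)    ≈⟨ Σ₁-cong T (λ s _ _ → ih s i j) ⟩
        Σ₁ T (λ s → lam′ s j * B i)    ≈⟨ Σ₁-*-distribʳ T (column lam′ j) (B i) ⟨
        Σ₁ T (column lam′ j) * B i     ∎

      δ-proportional : ∀ i j → δ t lam′ i * B j ≈ δ t lam′ j * B i
      δ-proportional i j = begin-equality
        δ t lam′ i * B j ≈⟨ increment-*-distribʳ _ _ _ _ (<⇒≤ (0<B j)) ⟩
        increment (ρ T i * B j) (lam′ t i * B j) (α * B i * B j) (Σ₁ T (column lam′ i) * B j)
          ≈⟨ increment-cong (ρ-proportional i j) (ih t i j)
                            (αB-proportional i j) (Σ-proportional i j) ⟩
        increment (ρ T j * B i) (lam′ t j * B i) (α * B j * B i) (Σ₁ T (column lam′ j) * B i)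
          ≈⟨ increment-*-distribʳ _ _ _ _ (<⇒≤ (0<B i)) ⟨
        δ t lam′ j * B i ∎

    Filled : ℕ → Sequence → Fin m → Set ℓ₂
    Filled n lam j = α * B j ≤ Σ₁ T (column lam j)
                   ⊎ (∀ s → 1 ℕ.≤ s → s ℕ.≤ n → ρ T j ≤ lam s j)

    -- Once the goal is reached it stays reached, since entries only grow. Until then, each step
    -- that does not reach the goal brings its own entry up to the cap.
    innerLoop-filled : ∀ {n} → n ℕ.≤ T → ∀ lam j → Filled n (innerLoop α T n lam) j
    innerLoop-filled {zero}  n≤T lam j = inj₂ λ s 1≤s s≤0 → contradiction (ℕ.≤-trans 1≤s s≤0) λ ()
    innerLoop-filled {suc n} n<T lam j
      with innerLoop-filled (ℕ.<⇒≤ n<T) lam j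
         | increment-lower (ρ T j) (lam′ (suc n) j) (α * B j) (Σ₁ T (column lam′ j))
      where lam′ = innerLoop α T n lam
    ... | inj₁ αB≤Σ | _ = inj₁ (≤-trans αB≤Σ
      (Σ₁-mono-≤ T λ s _ _ → ≤-update (suc n) (innerLoop α T n lam) s j))
    ... | inj₂ _ | inj₂ αB≤Σ+δ = inj₁ (≤-trans αB≤Σ+δ
      (≤-reflexive (≈-sym (update-Σ (s≤s z≤n) n<T (innerLoop α T n lam) j))))
    ... | inj₂ ρ≤lam | inj₁ ρ≤lam+δ = inj₂ λ s 1≤s s≤1+n →
      update-elim (λ s v → 1 ℕ.≤ s → s ℕ.≤ suc n → ρ T j ≤ v j) (suc n) (innerLoop α T n lam)
        (λ _ _ → ρ≤lam+δ)
        (λ s s≢1+n 1≤s s≤1+n → ρ≤lam s 1≤s (ℕ.≤-pred (ℕ.≤∧≢⇒< s≤1+n s≢1+n))) s 1≤s s≤1+n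

    -- If the goal was not reached along the way, all `T` entries are at least `ρ T j`; they then
    -- sum to at least `B j`, which suffices because `α ≤ 1#`.
    innerLoop-complete : 1 ℕ.≤ T → α ≤ 1# → ∀ lam j →
                         α * B j ≤ Σ₁ T (column (innerLoop α T T lam) j)
    innerLoop-complete 1≤T α≤1 lam j with innerLoop-filled ℕ.≤-refl lam j
    ... | inj₁ αB≤Σ = αB≤Σ
    ... | inj₂ ρ≤lam = begin
      α * B j           ≤⟨ *-monoˡ-≤ (<⇒≤ (0<B j)) α≤1 ⟩
      1# * B j          ≈⟨ *-identityˡ _ ⟩
      B j               ≈⟨ fromℕ*ρ≈B 1≤T j ⟨
      fromℕ T * ρ T j   ≈⟨ Σ₁-const T (ρ T j) ⟨
      Σ₁ T (λ _ → ρ T j) ≤⟨ Σ₁-mono-≤ T ρ≤lam ⟩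
      Σ₁ T (column (innerLoop α T T lam) j) ∎

    -- Each step is an instance of `tails-step`. By `innerLoop-filled`, either the goal is already
    -- met and the increment vanishes, or all earlier entries are at the cap, and then a nonzero
    -- increment does not overshoot the goal.
    innerLoop-tails : ∀ {N n lam j y} → T ℕ.≤ N → n ℕ.≤ T →
      α * B j ≤ Σ₁ T (λ s → y s ⊓ ρ T j) →
      TailsDominated N (column lam j) y →
      TailsDominated N (column (innerLoop α T n lam) j) y
    innerLoop-tails {n = zero}  T≤N n≤T αB≤ dom = dom
    innerLoop-tails {n = suc n} {lam} {j} {y} T≤N n<T αB≤ dom =
      tails-step {x = column lam′ j} {y = y} T≤N (s≤s z≤n) n<T
        (≈-reflexive (update-≡ (suc n) lam′ j)) (λ s s≢t → ≈-reflexive (update-≢ s≢t lam′ j))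
        alternative αB≤ (innerLoop-tails {lam = lam} {y = y} T≤N (ℕ.<⇒≤ n<T) αB≤ dom)
      where
      lam′ = innerLoop α T n lam
      alternative : δ (suc n) lam′ j ≈ 0#
        ⊎ (Σ₁ T (column lam′ j) + δ (suc n) lam′ j ≤ α * B j
           × (∀ s → 1 ℕ.≤ s → s ℕ.< suc n → ρ T j ≤ lam′ s j))
      alternative with innerLoop-filled (ℕ.<⇒≤ n<T) lam j
        | increment-upper (ρ T j) (lam′ (suc n) j) (α * B j) (Σ₁ T (column lam′ j))
      ... | inj₁ αB≤Σ | _ = inj₁ (increment≈0 _ _ _ _ αB≤Σ)
      ... | inj₂ _    | inj₁ δ≈0 = inj₁ δ≈0
      ... | inj₂ ρ≤   | inj₂ (_ , Σ+δ≤αB) = inj₂ (Σ+δ≤αB , λ s 1≤s s≤n → ρ≤ s 1≤s (ℕ.≤-pred s≤n))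

    FirstPositiveOrZero : Sequence → Fin m → Set (ℓ₁ ⊔ ℓ₂)
    FirstPositiveOrZero lam j = 0# < lam 1 j ⊎ (∀ s → lam s j ≤ 0#)

    -- Entry `1` is the first to be visited. If nothing is positive after some steps, entry `1` is
    -- below the cap, so by `innerLoop-filled` the goal is already met and later increments vanish.
    innerLoop-firstPositiveOrZero : ∀ {n} → n ℕ.≤ T → ∀ {lam j} →
      FirstPositiveOrZero lam j → FirstPositiveOrZero (innerLoop α T n lam) j
    innerLoop-firstPositiveOrZero {zero} n≤T alt = alt
    innerLoop-firstPositiveOrZero {suc n} n<T {lam} {j} alt
      with innerLoop-firstPositiveOrZero (ℕ.<⇒≤ n<T) {lam} {j} alt
    ... | inj₁ 0<lam = inj₁ (<-≤-trans 0<lam (≤-update (suc n) (innerLoop α T n lam) 1 j))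
    innerLoop-firstPositiveOrZero {suc zero} n<T {lam} {j} alt | inj₂ lam≤0
      with update α T 1 lam 1 j ≤? 0#
    ... | yes lam₁≤0 = inj₂ (update-elim (λ s v → v j ≤ 0#) 1 lam
            (≤-trans (≤-reflexive (≈-reflexive (≡.sym (update-≡ 1 lam j)))) lam₁≤0)
            (λ s _ → lam≤0 s))
    ... | no lam₁≰0 = inj₁ (≰⇒> lam₁≰0)
    innerLoop-firstPositiveOrZero {suc (suc n)} n<T {lam} {j} alt | inj₂ lam≤0
      with innerLoop-filled (ℕ.<⇒≤ n<T) lam j
    ... | inj₂ ρ≤ = inj₁ (<-≤-trans (0<ρ (ℕ.≤-trans (s≤s z≤n) n<T) j)
            (≤-trans (ρ≤ 1 (s≤s z≤n) (s≤s z≤n)) (≤-update (suc (suc n)) (innerLoop α T (suc n) lam) 1 j)))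
    ... | inj₁ αB≤Σ = inj₂ (update-elim (λ s v → v j ≤ 0#) (suc (suc n)) lam′
            (≤-trans (≤-reflexive (≈-trans (+-congˡ (increment≈0 _ _ _ _ αB≤Σ)) (+-identityʳ _)))
                     (lam≤0 _))
            (λ s _ → lam≤0 s))
      where lam′ = innerLoop α T (suc n) lam

  -- The outer loop, minimality and the equivalence.

  module _ {τ₁ τ₂ T_P : ℕ} (1≤τ₁ : 1 ℕ.≤ τ₁) (τ₁≤τ₂ : τ₁ ℕ.≤ τ₂)
           (τ₁≤T_P : τ₁ ℕ.≤ T_P) (T_P≤τ₂ : T_P ℕ.≤ τ₂)
           {β γ : Carrier} (0≤β : 0# ≤ β) (β≤1 : β ≤ 1#) (γ≤β : γ ≤ β) where

    private
      required : ℕ → Carrier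
      required = level T_P β γ

      λ* : Sequence
      λ* = optimalSequence τ₁ τ₂ T_P β γ

      end : τ₁ ℕ.+ (suc τ₂ ℕ.∸ τ₁) ≡ suc τ₂
      end = ℕ.m+[n∸m]≡n (ℕ.m≤n⇒m≤1+n τ₁≤τ₂)

    required-T_P : required T_P ≡ β
    required-T_P rewrite dec-true (T_P ℕ.≟ T_P) ≡.refl = ≡.refl

    required-elim : ∀ {p} (P : ℕ → Carrier → Set p) → P T_P β → (∀ T → P T γ) → ∀ T → P T (required T)
    required-elim P Pβ Pγ T with T ℕ.≡ᵇ T_P | ℕ.≡ᵇ⇒≡ T T_P
    ... | true  | T≡T_P with ≡.refl ← T≡T_P _ = Pβ
    ... | false | _ = Pγ T

    required≤β : ∀ T → required T ≤ β
    required≤β = required-elim (λ _ v → v ≤ β) ≤-refl (λ _ → γ≤β)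

    γ≤required : ∀ T → γ ≤ required T
    γ≤required = required-elim (λ _ v → γ ≤ v) γ≤β (λ _ → ≤-refl)

    required≤1 : ∀ T → required T ≤ 1#
    required≤1 T = ≤-trans (required≤β T) β≤1

    Satisfactory : Sequence → Set ℓ₂
    Satisfactory lam = β ≤ c lam T_P × γ ≤ minRange τ₁ τ₂ (c lam)

    -- The levels `required T` merge both requirements into one family of bounds; at `T_P`,
    -- competitiveness follows from `γ ≤ β`.
    satisfactory : ∀ {lam} → (∀ T → τ₁ ℕ.≤ T → T ℕ.≤ τ₂ → required T ≤ c lam T) → Satisfactory lam
    satisfactory {lam} a≤c =
        ≤-trans (≤-reflexive (≈-reflexive (≡.sym required-T_P))) (a≤c T_P τ₁≤T_P T_P≤τ₂)
      , ≤-minRange (c lam) τ₁≤τ₂ λ T τ₁≤T T≤τ₂ → ≤-trans (γ≤required T) (a≤c T τ₁≤T T≤τ₂)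

    satisfactory⇒required≤c : ∀ {lam} → Satisfactory lam →
                           ∀ T → τ₁ ℕ.≤ T → T ℕ.≤ τ₂ → required T ≤ c lam T
    satisfactory⇒required≤c {lam} (β≤c , γ≤min) = required-elim
      (λ T v → τ₁ ℕ.≤ T → T ℕ.≤ τ₂ → v ≤ c lam T) (λ _ _ → β≤c)
      (λ T τ₁≤T T≤τ₂ → ≤-trans γ≤min (minRange-≤ (c lam) τ₁≤T T≤τ₂))

    -- `P T lam` describes the state once the passes for all horizons from `T` upwards are done. The
    -- index therefore starts one above the largest horizon and each pass lowers it by one.
    outerLoop-induction : ∀ {p} (P : ℕ → Sequence → Set p) n →
      (∀ {T lam} → τ₁ ℕ.≤ T → T ℕ.< τ₁ ℕ.+ n → P (suc T) lam → P T (innerLoop (required T) T T lam)) →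
      ∀ {lam} → P (τ₁ ℕ.+ n) lam → P τ₁ (outerLoop τ₁ T_P β γ n lam)
    outerLoop-induction P zero step {lam} init = ≡.subst (λ T → P T lam) (ℕ.+-identityʳ τ₁) init
    outerLoop-induction P (suc n) step {lam} init = outerLoop-induction P n
      (λ τ₁≤T T<τ₁+n → step τ₁≤T (ℕ.≤-trans T<τ₁+n (ℕ.+-monoʳ-≤ τ₁ (ℕ.n≤1+n n))))
      (step (ℕ.m≤m+n τ₁ n) (ℕ.≤-reflexive (≡.sym (ℕ.+-suc τ₁ n)))
        (≡.subst (λ T → P T lam) (ℕ.+-suc τ₁ n) init))

    optimalSequence-induction : ∀ {p} (P : ℕ → Sequence → Set p) →
      (∀ {T lam} → τ₁ ℕ.≤ T → T ℕ.≤ τ₂ → P (suc T) lam → P T (innerLoop (required T) T T lam)) →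
      P (suc τ₂) (λ _ _ → 0#) → P τ₁ λ*
    optimalSequence-induction P step init = outerLoop-induction P (suc τ₂ ℕ.∸ τ₁)
      (λ τ₁≤T T<end → step τ₁≤T (ℕ.≤-pred (ℕ.≤-trans T<end (ℕ.≤-reflexive end))))
      (≡.subst (λ T → P T (λ _ _ → 0#)) (≡.sym end) init)

    optimalSequence-nonNegative : ∀ s j → 0# ≤ λ* s j
    optimalSequence-nonNegative = optimalSequence-induction
      (λ _ lam → ∀ s j → 0# ≤ lam s j)
      (λ {T} {lam} _ _ 0≤lam s j → ≤-trans (0≤lam s j) (≤-innerLoop (required T) T T lam s j))
      (λ _ _ → ≤-refl)

    -- The invariant also carries cap and proportionality, which turn the completed sum for the
    -- current horizon into a bound on `c`. Bounds for larger horizons survive because `c` is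
    -- monotone.
    optimalSequence-satisfactory : Satisfactory λ*
    optimalSequence-satisfactory = satisfactory {λ*} (proj₂ (proj₂ (optimalSequence-induction
      (λ T lam → Capped T lam × Proportional lam
               × (∀ T′ → T ℕ.≤ T′ → T′ ℕ.≤ τ₂ → required T′ ≤ c lam T′))
      step
      ( (λ s j → <⇒≤ (0<ρ {suc τ₂} (s≤s z≤n) j)) , (λ s i j → ≈-trans (zeroˡ (B j)) (≈-sym (zeroˡ (B i))))
      , λ T′ τ₂<T′ T′≤τ₂ → contradiction T′≤τ₂ (ℕ.<⇒≱ τ₂<T′)))))
      where
      step : ∀ {T lam} → τ₁ ℕ.≤ T → T ℕ.≤ τ₂ →
        Capped (suc T) lam × Proportional lam
          × (∀ T′ → suc T ℕ.≤ T′ → T′ ℕ.≤ τ₂ → required T′ ≤ c lam T′) →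
        let lam′ = innerLoop (required T) T T lam in
        Capped T lam′ × Proportional lam′
          × (∀ T′ → T ℕ.≤ T′ → T′ ℕ.≤ τ₂ → required T′ ≤ c lam′ T′)
      step {T} {lam} τ₁≤T T≤τ₂ (cap , prop , a≤c) = cap′ , prop′ , a≤c′
        where
        1≤T = ℕ.≤-trans 1≤τ₁ τ₁≤T
        -- The rate `ρ` grows as the horizon shrinks, so the cap for `suc T` implies the one for `T`
        -- before the pass starts.
        cap′ = innerLoop-capped (required T) T T
          λ s j → ≤-trans (cap s j) (ρ-antitone 1≤T (ℕ.n≤1+n T) j)
        prop′ = innerLoop-proportional (required T) T T prop
        a≤c′ : ∀ T′ → T ℕ.≤ T′ → T′ ℕ.≤ τ₂ → required T′ ≤ c (innerLoop (required T) T T lam) T′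
        a≤c′ T′ T≤T′ T′≤τ₂ with T ℕ.≟ T′
        ... | yes ≡.refl = *B≤Σ⇒≤c 1≤T cap′ prop′ someResource
          (innerLoop-complete (required T) T 1≤T (required≤1 T) lam someResource)
        ... | no T≢T′ = ≤-trans (a≤c T′ (ℕ.≤∧≢⇒< T≤T′ T≢T′) T′≤τ₂)
          (c-mono-≤ (ℕ.≤-trans 1≤T T≤T′) (≤-innerLoop (required T) T T lam))

    -- This is tail dominance at `k = 0`, where both prefix sums are `0#`. Dominance holds initially
    -- because `lam` is nonnegative, and every pass preserves it.
    optimalSequence-minimal : ∀ {lam} →
      (∀ t → 1 ℕ.≤ t → t ℕ.≤ τ₂ → ∀ j → 0# ≤ lam t j) → Satisfactory lam → ∀ j →
      Σ₁ τ₂ (column λ* j) ≤ Σ₁ τ₂ (column lam j)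
    optimalSequence-minimal {lam} 0≤lam sat j = +-cancelʳ-≤ 0# (dominated {0} z≤n)
      where
      dominated : TailsDominated τ₂ (column λ* j) (column lam j)
      dominated = optimalSequence-induction
        (λ _ lam′ → TailsDominated τ₂ (column lam′ j) (column lam j))
        (λ {T} {lam′} τ₁≤T T≤τ₂ → innerLoop-tails (required T) T {lam = lam′} {y = column lam j} T≤τ₂ ℕ.≤-refl
          (≤c⇒*B≤Σ⊓ρ {lam} (ℕ.≤-trans 1≤τ₁ τ₁≤T) (satisfactory⇒required≤c {lam} sat T τ₁≤T T≤τ₂) j))
        (pointwise⇒tails τ₂ λ t 1≤t t≤τ₂ → 0≤lam t 1≤t t≤τ₂ j)

    -- As long as entry `1` is not positive, no entry is. This cannot outlast the pass for `T_P`,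
    -- which leaves a sum of at least `β * B j`, a positive amount.
    optimalSequence-positive : 0# < β → ∀ j → 0# < λ* 1 j
    optimalSequence-positive 0<β j with optimalSequence-induction
      (λ T lam → 0# < lam 1 j ⊎ ((∀ s → lam s j ≤ 0#) × T_P ℕ.< T))
      step (inj₂ ((λ _ → ≤-refl) , s≤s T_P≤τ₂))
      where
      step : ∀ {T lam} → τ₁ ℕ.≤ T → T ℕ.≤ τ₂ →
        0# < lam 1 j ⊎ ((∀ s → lam s j ≤ 0#) × T_P ℕ.< suc T) →
        let lam′ = innerLoop (required T) T T lam in
        0# < lam′ 1 j ⊎ ((∀ s → lam′ s j ≤ 0#) × T_P ℕ.< T)
      step {T} {lam} τ₁≤T T≤τ₂ (inj₁ 0<lam₁) =
        inj₁ (<-≤-trans 0<lam₁ (≤-innerLoop (required T) T T lam 1 j))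
      step {T} {lam} τ₁≤T T≤τ₂ (inj₂ (lam≤0 , T_P<1+T))
        with innerLoop-firstPositiveOrZero (required T) T ℕ.≤-refl {lam} {j} (inj₂ lam≤0)
           | T_P ℕ.≟ T
      ... | inj₁ 0<lam′₁ | _ = inj₁ 0<lam′₁
      ... | inj₂ lam′≤0  | no T_P≢T = inj₂ (lam′≤0 , ℕ.≤∧≢⇒< (ℕ.≤-pred T_P<1+T) T_P≢T)
      ... | inj₂ lam′≤0  | yes ≡.refl = contradiction (begin
        β * B j       ≡⟨ ≡.cong (_* B j) required-T_P ⟨
        required T * B j    ≤⟨ innerLoop-complete (required T) T (ℕ.≤-trans 1≤τ₁ τ₁≤T) (required≤1 T) lam j ⟩
        Σ₁ T (column (innerLoop (required T) T T lam) j) ≤⟨ Σ₁-nonPositive T lam′≤0 ⟩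
        0#            ∎) (<⇒≱ (*-positive 0<β (0<B j)))
    ... | inj₁ 0<λ*₁ = 0<λ*₁
    ... | inj₂ (_ , T_P<τ₁) = contradiction τ₁≤T_P (ℕ.<⇒≱ T_P<τ₁)

    -- For `β ≈ 0#` the algorithm returns the zero sequence, which is not a target consumption
    -- sequence because its first entry is not positive. Spending the whole budget at time 1 serves
    -- as witness instead.
    allAtOnce : Sequence
    allAtOnce t j = if does (t ℕ.≟ 1) then B j else 0#

    allAtOnce-nonNegative : ∀ t j → 0# ≤ allAtOnce t j
    allAtOnce-nonNegative t j with t ℕ.≡ᵇ 1
    ... | true  = <⇒≤ (0<B j)
    ... | false = ≤-refl

    allAtOnce-isTargetConsumption : IsTargetConsumption τ₂ allAtOnce
    allAtOnce-isTargetConsumption = (λ t _ _ → allAtOnce-nonNegative t) , 0<B , λ j → begin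
      Σ₁ τ₂ (column allAtOnce j)
        ≈⟨ Σ₁-perturb {λ _ → 0#} (≈-sym (+-identityˡ (B j))) (elsewhere j) (s≤s z≤n) 1≤τ₂ ⟩
      Σ₁ τ₂ (λ _ → 0#) + B j ≤⟨ +-monoˡ-≤ (B j) (Σ₁-nonPositive τ₂ λ _ → ≤-refl) ⟩
      0# + B j               ≈⟨ +-identityˡ (B j) ⟩
      B j                    ∎
      where
      1≤τ₂ = ℕ.≤-trans 1≤τ₁ τ₁≤τ₂
      elsewhere : ∀ j s → s ≢ 1 → allAtOnce s j ≈ 0#
      elsewhere j s s≢1 rewrite dec-false (s ℕ.≟ 1) s≢1 = ≈-refl

    allAtOnce-satisfactory : β ≈ 0# → Satisfactory allAtOnce
    allAtOnce-satisfactory β≈0 = satisfactory {allAtOnce} λ T τ₁≤T _ → begin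
      required T          ≤⟨ required≤β T ⟩
      β             ≈⟨ β≈0 ⟩
      0#            ≤⟨ 0≤c {allAtOnce} (ℕ.≤-trans 1≤τ₁ τ₁≤T) allAtOnce-nonNegative ⟩
      c allAtOnce T ∎

    target-exists : WithinBudget τ₂ λ* →
                    ∃[ lam ] (IsTargetConsumption τ₂ lam × Satisfactory lam)
    target-exists λ*≤B with β ≈? 0#
    ... | yes β≈0 = allAtOnce , allAtOnce-isTargetConsumption , allAtOnce-satisfactory β≈0
    ... | no β≉0  = λ*
      , ( (λ t _ _ → optimalSequence-nonNegative t)
        , optimalSequence-positive (0≤β , λ 0≈β → β≉0 (≈-sym 0≈β))
        , λ*≤B)
      , optimalSequence-satisfactory

    target⇒withinBudget : ∃[ lam ] (IsTargetConsumption τ₂ lam × Satisfactory lam) →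
                          WithinBudget τ₂ λ*
    target⇒withinBudget (lam , (0≤lam , _ , lam≤B) , sat) j =
      ≤-trans (optimalSequence-minimal 0≤lam sat j) (lam≤B j)

theorem3 :
    {a ℓ₁ ℓ₂ : Level} (K : OrderedField a ℓ₁ ℓ₂) →
    let open OrderedField K in
    (m : ℕ) .{{m≢0 : NonZero m}} (B : Vector Carrier m) → (∀ j → 0# < B j) →
    (τ₁ τ₂ T_P : ℕ) → 1 ℕ.≤ τ₁ → τ₁ ℕ.≤ τ₂ → τ₁ ℕ.≤ T_P → T_P ℕ.≤ τ₂ →
    (β γ : Carrier) → 0# ≤ β → β ≤ 1# → 0# ≤ γ → γ ≤ β →
    let open Consumption K B
        λ* = optimalSequence τ₁ τ₂ T_P β γ
    in
      (β ≤ c λ* T_P × γ ≤ minRange τ₁ τ₂ (c λ*))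
    × (WithinBudget τ₂ λ*
       ⇔ (∃[ λ′ ] (IsTargetConsumption τ₂ λ′
                   × β ≤ c λ′ T_P
                   × γ ≤ minRange τ₁ τ₂ (c λ′))))
theorem3 K m B 0<B τ₁ τ₂ T_P 1≤τ₁ τ₁≤τ₂ τ₁≤T_P T_P≤τ₂ β γ 0≤β β≤1 _ γ≤β =
    optimalSequence-satisfactory 1≤τ₁ τ₁≤τ₂ τ₁≤T_P T_P≤τ₂ 0≤β β≤1 γ≤β
  , mk⇔ (target-exists 1≤τ₁ τ₁≤τ₂ τ₁≤T_P T_P≤τ₂ 0≤β β≤1 γ≤β)
        (target⇒withinBudget 1≤τ₁ τ₁≤τ₂ τ₁≤T_P T_P≤τ₂ 0≤β β≤1 γ≤β)
  where open ConsumptionProperties K B 0<B
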